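{- Let $\sigma$ be an integer sequence of length $n$. Then $\Theta(\sigma)\in FP_n$ if and only if $\sigma$ avoids both patterns $101$ and $201$.
   Context: $I_n$ is the set of inversion sequences of length $n$, i.e. integer sequences $\sigma=(\sigma_1,\ldots,\sigma_n)$ with $0\le\sigma_i<i$ for every $1\le i\le n$. For a finite integer sequence $\sigma$ of length $n$, $\Theta(\sigma)$ is the sequence of length $n$ defined by $\Theta(\sigma)_i=\#\{j<i:\sigma_j<\sigma_i\}$. $FP_n=\{\sigma\in I_n:\Theta(\sigma)=\sigma\}$. A sequence $\sigma$ avoids $101$ if there are no indices $a<b<c$ with $\sigma_a=\sigma_c>\sigma_b$; it avoids $201$ if there are no indices $a<b<c$ with $\sigma_a>\sigma_c>\sigma_b$. -}

module Defs where

open import Data.Fin.Base as Fin using (Fin; toℕ)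
import Data.Fin.Properties as Fin
open import Data.Integer.Base using (ℤ; +_; 0ℤ; _≤_; _<_; _>_)
open import Data.Integer.Properties using (_<?_)
open import Data.Nat.Base using (ℕ; suc)
open import Data.Product.Base using (_×_; ∃-syntax)
open import Data.Vec.Base using (Vec; lookup; tabulate; allFin; count)
open import Level using (0ℓ)
open import Relation.Binary.PropositionalEquality using (_≡_)
open import Relation.Nullary.Decidable using (_×-dec_)
open import Relation.Nullary.Negation using (¬_)
open import Relation.Unary using (Pred; _∈_)

-- Positions are Fin n, hence 0-based: the 1-based index of i is suc (toℕ i).
I : (n : ℕ) → Pred (Vec ℤ n) 0ℓ
I n σ = ∀ (i : Fin n) → 0ℤ ≤ lookup σ i × lookup σ i < + suc (toℕ i)

Θ : ∀ {n} → Vec ℤ n → Vec ℤ n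
Θ {n} σ = tabulate λ i →
  + count (λ j → (j Fin.<? i) ×-dec (lookup σ j <? lookup σ i)) (allFin n)

FP : (n : ℕ) → Pred (Vec ℤ n) 0ℓ
FP n σ = σ ∈ I n × Θ σ ≡ σ

Avoids101 : ∀ {n} → Pred (Vec ℤ n) 0ℓ
Avoids101 σ = ¬ (∃[ a ] ∃[ b ] ∃[ c ]
  (a Fin.< b × b Fin.< c) ×
  (lookup σ a ≡ lookup σ c × lookup σ c > lookup σ b))

Avoids201 : ∀ {n} → Pred (Vec ℤ n) 0ℓ
Avoids201 σ = ¬ (∃[ a ] ∃[ b ] ∃[ c ]
  (a Fin.< b × b Fin.< c) ×
  (lookup σ a > lookup σ c × lookup σ c > lookup σ b))

{-# OPTIONS --safe #-}

-- For τ = Θ σ, a smaller earlier entry of σ always gives a smaller earlier entry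
-- of τ, so τ is fixed by Θ iff the converse also holds.  Avoiding 101 and 201
-- means that no σ_c > σ_b has an earlier σ_a ≥ σ_c, a < b < c.  For σ with this
-- property, j < i and σ_j ≥ σ_i force every smaller entry preceding i to precede
-- j, so τ_j ≥ τ_i, which is the converse.  A fixed point τ always has the
-- property: if τ_a ≥ v then at least v entries before a are smaller than v, so
-- an occurrence with v = τ_c would give at least v + 1 such entries before c.

module Submission where

open import Defs
open import Data.Fin.Base as Fin using (Fin; zero; suc; toℕ)
import Data.Fin.Induction as Fin
import Data.Fin.Properties as Fin
open import Data.Integer.Base using (ℤ; +_; _≤_; _<_; +≤+; +<+)
open import Data.Integer.Properties
  using (_<?_; _≤?_; ≮⇒≥; ≰⇒>; ≤∧≢⇒<; ≤-trans; ≤-reflexive;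
         <-irrefl; <-trans; <-≤-trans; <⇒≤; <⇒≱; module ≤-Reasoning)
open import Data.Nat.Base as ℕ using (ℕ; zero; suc; z≤n; s≤s)
import Data.Nat.Properties as ℕ
open import Data.Product.Base using (_×_; _,_; proj₁; proj₂)
open import Data.Vec.Base using (Vec; []; _∷_; lookup; tabulate; allFin; count)
import Data.Vec.Membership.Propositional as Vec
open import Data.Vec.Membership.Propositional.Properties using (∈-allFin⁺)
open import Data.Vec.Properties using (lookup∘tabulate; tabulate-cong)
open import Data.Vec.Relation.Unary.Any using (here; there)
open import Function.Base using (id; _∘_)
open import Function.Bundles using (_⇔_; mk⇔)
open import Induction.WellFounded using (Acc; acc)
open import Level using (Level; 0ℓ)
open import Relation.Binary.Definitions using (tri<; tri≈; tri>)
open import Relation.Binary.PropositionalEquality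
  using (_≡_; refl; sym; trans; cong; subst₂)
open import Relation.Nullary.Decidable using (yes; no; _×-dec_; decidable-stable)
open import Relation.Nullary.Negation using (¬_; contradiction)
open import Relation.Unary using (Pred; Decidable; _∈_; _⊆_)

private variable
  a p q : Level
  A : Set a
  m n : ℕ

module _ {P : Pred A p} {Q : Pred A q} (P? : Decidable P) (Q? : Decidable Q) (P⊆Q : P ⊆ Q) where

  count-mono-≤ : (xs : Vec A n) → count P? xs ℕ.≤ count Q? xs
  count-mono-≤ []       = z≤n
  count-mono-≤ (x ∷ xs) with P? x | Q? x
  ... | yes _  | yes _  = s≤s (count-mono-≤ xs)
  ... | yes px | no ¬qx = contradiction (P⊆Q px) ¬qx
  ... | no _   | yes _  = ℕ.m≤n⇒m≤1+n (count-mono-≤ xs)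
  ... | no _   | no _   = count-mono-≤ xs

  count-mono-< : ∀ {y} {xs : Vec A n} → y Vec.∈ xs → ¬ P y → Q y → count P? xs ℕ.< count Q? xs
  count-mono-< {xs = x ∷ xs} (here refl) ¬py qy with P? x | Q? x
  ... | yes px | _      = contradiction px ¬py
  ... | no _   | yes _  = s≤s (count-mono-≤ xs)
  ... | no _   | no ¬qx = contradiction qy ¬qx
  count-mono-< {xs = x ∷ xs} (there y∈xs) ¬py qy with P? x | Q? x
  ... | yes _  | yes _  = s≤s (count-mono-< y∈xs ¬py qy)
  ... | yes px | no ¬qx = contradiction (P⊆Q px) ¬qx
  ... | no _   | yes _  = ℕ.m≤n⇒m≤1+n (count-mono-< y∈xs ¬py qy)
  ... | no _   | no _   = count-mono-< y∈xs ¬py qy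

-- Only the first `m` positions can contribute. The induction drops the head and lowers `m`
-- together; at `m = 0` the bound is absurd for every position.
count-tabulate-≤ : {P : Pred A p} (P? : Decidable P) (f : Fin n → A) →
                   (∀ k → P (f k) → toℕ k ℕ.< m) → count P? (tabulate f) ℕ.≤ m
count-tabulate-≤ {n = zero}              P? f bound = z≤n
count-tabulate-≤ {n = suc _} {m = zero}  P? f bound with P? (f zero)
... | yes pf = contradiction (bound zero pf) λ ()
... | no _   = count-tabulate-≤ P? (f ∘ suc) λ k pf → contradiction (bound (suc k) pf) λ ()
count-tabulate-≤ {n = suc _} {m = suc _} P? f bound with P? (f zero)
... | yes _ = s≤s (count-tabulate-≤ P? (f ∘ suc) λ k → ℕ.s<s⁻¹ ∘ bound (suc k))
... | no _  = ℕ.m≤n⇒m≤1+n (count-tabulate-≤ P? (f ∘ suc) λ k → ℕ.s<s⁻¹ ∘ bound (suc k))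

-- `Θ` counts this with `v = lookup σ i`. The threshold is kept separate so that it can stay fixed
-- while `i` moves.
EarlierBelow : Vec ℤ n → ℤ → Fin n → Pred (Fin n) 0ℓ
EarlierBelow σ v i j = j Fin.< i × lookup σ j < v

earlierBelow? : (σ : Vec ℤ n) (v : ℤ) (i : Fin n) → Decidable (EarlierBelow σ v i)
earlierBelow? σ v i j = (j Fin.<? i) ×-dec (lookup σ j <? v)

#earlierBelow : Vec ℤ n → ℤ → Fin n → ℕ
#earlierBelow {n} σ v i = count (earlierBelow? σ v i) (allFin n)

module _ (σ τ : Vec ℤ n) {v w : ℤ} {i j : Fin n}
         (incl : EarlierBelow σ v i ⊆ EarlierBelow τ w j) where

  #earlierBelow-mono-≤ : #earlierBelow σ v i ℕ.≤ #earlierBelow τ w j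
  #earlierBelow-mono-≤ = count-mono-≤ (earlierBelow? σ v i) (earlierBelow? τ w j) incl (allFin n)

  #earlierBelow-mono-< : ∀ k → ¬ EarlierBelow σ v i k → EarlierBelow τ w j k →
                         #earlierBelow σ v i ℕ.< #earlierBelow τ w j
  #earlierBelow-mono-< k = count-mono-< (earlierBelow? σ v i) (earlierBelow? τ w j) incl (∈-allFin⁺ k)

lookup-Θ : (σ : Vec ℤ n) (i : Fin n) → lookup (Θ σ) i ≡ + #earlierBelow σ (lookup σ i) i
lookup-Θ σ = lookup∘tabulate _

Θ∈I : (σ : Vec ℤ n) → Θ σ ∈ I n
Θ∈I σ i rewrite lookup-Θ σ i =
  -- `allFin n` unfolds to `tabulate id`, and a counted position precedes `i`, so the count is at
  -- most `toℕ i`.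
  +≤+ z≤n , +<+ (s≤s (count-tabulate-≤ (earlierBelow? σ (lookup σ i) i) id λ _ → proj₁))

-- Whatever is counted at `j` is counted at `i`, and `j` itself is counted only at `i`.
Θ-mono-< : (σ : Vec ℤ n) {j i : Fin n} → j Fin.< i → lookup σ j < lookup σ i →
           lookup (Θ σ) j < lookup (Θ σ) i
Θ-mono-< σ {j} {i} j<i σj<σi = subst₂ _<_ (sym (lookup-Θ σ j)) (sym (lookup-Θ σ i))
  (+<+ (#earlierBelow-mono-< σ σ (λ (k<j , σk<σj) → Fin.<-trans k<j j<i , <-trans σk<σj σj<σi)
    j (Fin.<-irrefl refl ∘ proj₁) (j<i , σj<σi)))

NoDipBelow : Pred (Vec ℤ n) 0ℓ
NoDipBelow σ = ∀ {a b c} → a Fin.< b → b Fin.< c → lookup σ c ≤ lookup σ a → ¬ lookup σ b < lookup σ c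

avoids⇒noDip : (σ : Vec ℤ n) → σ ∈ Avoids101 → σ ∈ Avoids201 → NoDipBelow σ
avoids⇒noDip σ ¬101 ¬201 a<b b<c σc≤σa σb<σc = ¬201
  (_ , _ , _ , (a<b , b<c) ,
   ≤∧≢⇒< σc≤σa (λ σc≡σa → ¬101 (_ , _ , _ , (a<b , b<c) , sym σc≡σa , σb<σc)) , σb<σc)

noDip⇒avoids : (σ : Vec ℤ n) → NoDipBelow σ → σ ∈ Avoids101 × σ ∈ Avoids201
noDip⇒avoids σ noDip =
  (λ (_ , _ , _ , (a<b , b<c) , σa≡σc , σb<σc) →
     noDip a<b b<c (≤-reflexive (sym σa≡σc)) σb<σc) ,
  (λ (_ , _ , _ , (a<b , b<c) , σc<σa , σb<σc) → noDip a<b b<c (<⇒≤ σc<σa) σb<σc)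

noDip⇒Θ-mono-≤ : (σ : Vec ℤ n) → NoDipBelow σ → {j i : Fin n} → j Fin.< i →
                 lookup σ i ≤ lookup σ j → lookup (Θ σ) i ≤ lookup (Θ σ) j
noDip⇒Θ-mono-≤ σ noDip {j} {i} j<i σi≤σj =
  subst₂ _≤_ (sym (lookup-Θ σ i)) (sym (lookup-Θ σ j)) (+≤+ (#earlierBelow-mono-≤ σ σ earlier))
  where
  earlier : EarlierBelow σ (lookup σ i) i ⊆ EarlierBelow σ (lookup σ j) j
  earlier {k} (k<i , σk<σi) with Fin.<-cmp k j
  ... | tri< k<j _ _  = k<j , <-≤-trans σk<σi σi≤σj
  ... | tri≈ _ refl _ = contradiction σi≤σj (<⇒≱ σk<σi)
  -- Here `j`, `k`, `i` would form a forbidden triple with `k` as its dip.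
  ... | tri> _ _ j<k  = contradiction σk<σi (noDip j<k k<i σi≤σj)

earlierBelow-Θ : (σ : Vec ℤ n) (i : Fin n) →
                 EarlierBelow σ (lookup σ i) i ⊆ EarlierBelow (Θ σ) (lookup (Θ σ) i) i
earlierBelow-Θ σ i (j<i , σj<σi) = j<i , Θ-mono-< σ j<i σj<σi

noDip⇒Θ-fixed : (σ : Vec ℤ n) → NoDipBelow σ → Θ (Θ σ) ≡ Θ σ
noDip⇒Θ-fixed σ noDip = tabulate-cong λ i → cong +_ (ℕ.≤-antisym
  (#earlierBelow-mono-≤ (Θ σ) σ (reflects i))
  (#earlierBelow-mono-≤ σ (Θ σ) (earlierBelow-Θ σ i)))
  where
  reflects : ∀ i → EarlierBelow (Θ σ) (lookup (Θ σ) i) i ⊆ EarlierBelow σ (lookup σ i) i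
  reflects i {j} (j<i , Θj<Θi) = j<i , decidable-stable (lookup σ j <? lookup σ i)
    λ σj≮σi → <⇒≱ Θj<Θi (noDip⇒Θ-mono-≤ σ noDip j<i (≮⇒≥ σj≮σi))

module _ (τ : Vec ℤ n) (fixed : Θ τ ≡ τ) where

  lookup-fixed : ∀ i → lookup τ i ≡ + #earlierBelow τ (lookup τ i) i
  lookup-fixed i = trans (cong (λ ρ → lookup ρ i) (sym fixed)) (lookup-Θ τ i)

  -- Moving to an earlier entry that is at least `v` can only lower the count, so it suffices to
  -- treat an `i` before which all entries are below `v`. There the count for `v` includes every
  -- position counted for `lookup τ i`, and that count is `lookup τ i` itself since `τ` is fixed.
  fixed⇒≤#earlierBelow : ∀ v i → v ≤ lookup τ i → v ≤ + #earlierBelow τ v i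
  fixed⇒≤#earlierBelow v i = go (Fin.<-wellFounded i)
    where
    go : ∀ {i} → Acc Fin._<_ i → v ≤ lookup τ i → v ≤ + #earlierBelow τ v i
    go {i} (acc rs) v≤τi with Fin.any? (λ j → (j Fin.<? i) ×-dec (v ≤? lookup τ j))
    ... | yes (j , j<i , v≤τj) = ≤-trans (go (rs j<i) v≤τj)
      (+≤+ (#earlierBelow-mono-≤ τ τ λ (k<j , τk<v) → Fin.<-trans k<j j<i , τk<v))
    ... | no none = ≤-trans v≤τi (≤-trans (≤-reflexive (lookup-fixed i))
      (+≤+ (#earlierBelow-mono-≤ τ τ λ (k<i , _) → k<i , ≰⇒> λ v≤τk → none (_ , k<i , v≤τk))))

  fixed⇒noDip : NoDipBelow τ
  fixed⇒noDip {a} {b} {c} a<b b<c τc≤τa τb<τc = <-irrefl refl (begin-strict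
    lookup τ c                          ≤⟨ fixed⇒≤#earlierBelow (lookup τ c) a τc≤τa ⟩
    + #earlierBelow τ (lookup τ c) a    <⟨ +<+ fewer ⟩
    + #earlierBelow τ (lookup τ c) c    ≡⟨ lookup-fixed c ⟨
    lookup τ c                          ∎)
    where
    open ≤-Reasoning
    fewer : #earlierBelow τ (lookup τ c) a ℕ.< #earlierBelow τ (lookup τ c) c
    fewer = #earlierBelow-mono-< τ τ
      (λ (k<a , τk<τc) → Fin.<-trans k<a (Fin.<-trans a<b b<c) , τk<τc)
      -- The dip `b` is the extra position: it lies after `a`, before `c`, and its entry is below
      -- `lookup τ c`.
      b (λ (b<a , _) → Fin.<-asym a<b b<a) (b<c , τb<τc)

-- By `earlierBelow-Θ` the positions counted at `i` for `σ` are among those for `Θ σ`. Both counts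
-- equal `lookup (Θ σ) i`, so there is no room for a further `j` in the second set.
Θ-fixed⇒Θ-reflects-< : (σ : Vec ℤ n) → Θ (Θ σ) ≡ Θ σ → {j i : Fin n} → j Fin.< i →
                       lookup (Θ σ) j < lookup (Θ σ) i → lookup σ j < lookup σ i
Θ-fixed⇒Θ-reflects-< σ fixed {j} {i} j<i Θj<Θi =
  decidable-stable (lookup σ j <? lookup σ i) λ σj≮σi →
    <-irrefl (trans (sym (lookup-Θ σ i)) (lookup-fixed (Θ σ) fixed i))
      (+<+ (#earlierBelow-mono-< σ (Θ σ) (earlierBelow-Θ σ i) j (σj≮σi ∘ proj₂) (j<i , Θj<Θi)))

-- A forbidden triple of `σ` would be one of the fixed point `Θ σ` at the same positions: `Θ-mono-<`
-- carries over the strict inequality, and the contrapositive of reflection the weak one.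
Θ-fixed⇒noDip : (σ : Vec ℤ n) → Θ (Θ σ) ≡ Θ σ → NoDipBelow σ
Θ-fixed⇒noDip σ fixed a<b b<c σc≤σa σb<σc = fixed⇒noDip (Θ σ) fixed a<b b<c
  (≮⇒≥ λ Θa<Θc → <⇒≱ (Θ-fixed⇒Θ-reflects-< σ fixed (Fin.<-trans a<b b<c) Θa<Θc) σc≤σa)
  (Θ-mono-< σ b<c σb<σc)

theorem5p1 : ∀ (n : ℕ) (σ : Vec ℤ n) →
    Θ σ ∈ FP n ⇔ (σ ∈ Avoids101 × σ ∈ Avoids201)
theorem5p1 n σ = mk⇔
  (λ (_ , fixed) → noDip⇒avoids σ (Θ-fixed⇒noDip σ fixed))
  (λ (¬101 , ¬201) → Θ∈I σ , noDip⇒Θ-fixed σ (avoids⇒noDip σ ¬101 ¬201))
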